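{- Every signified graph $(G,\Sigma)$ whose underlying graph $G$ is outerplanar with girth at least $4$ admits a signified homomorphism to $AT(K_4^*)$, where $K_4^*$ is the complete graph on $4$ vertices with exactly one negative edge.
   Context: A signified graph $(G,\Sigma)$ is a simple graph $G$ with a set $\Sigma\subseteq E(G)$ of negative edges, other edges positive. A signified homomorphism of $(G,\Sigma)$ to $(H,\Lambda)$ is a map $V(G)\to V(H)$ sending every edge to an edge of the same sign. For a signified graph $(H,\Lambda)$, $AT(H,\Lambda)$ has vertex set $\{u_0,u_1:u\in V(H)\}$; for every edge $uv$ of $H$ it has edges $u_0v_0,u_1v_1$ with the sign of $uv$ and $u_0v_1,u_1v_0$ with the opposite sign; no other edges. The girth is the length of a shortest cycle (infinite for forests). -}

module Defs where

open import Data.Bool using (Bool; true; false; T; not; _∧_; _xor_)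
open import Data.Bool.Properties using (T-∧; xor-comm)
open import Data.Fin using (Fin; zero; suc; inject₁; fromℕ)
open import Data.Fin.Properties using (_≟_)
open import Data.Nat using (ℕ; suc; _+_; _*_; _≤_)
open import Data.Nat.GeneralisedArithmetic using (iterate)
open import Data.Product using (∃; _×_; _,_; proj₁)
open import Data.Sum using (_⊎_)
open import Function.Bundles using (_⇔_; Equivalence)
open import Function.Definitions using (Injective; StrictlySurjective)
open import Relation.Binary.Construct.Closure.ReflexiveTransitive using (Star)
open import Relation.Binary.PropositionalEquality
  using (_≡_; refl; sym; subst; cong₂)
open import Relation.Nullary using (yes; no; contradiction)
open import Relation.Nullary.Decidable using (⌊_⌋)

record Graph (V : Set) : Set where
  field
    adj        : V → V → Bool
    adj-sym    : ∀ u v → adj u v ≡ adj v u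
    adj-irrefl : ∀ v → adj v v ≡ false

record SignifiedGraph (V : Set) : Set where
  field
    graph   : Graph V
  open Graph graph public
  field
    neg     : V → V → Bool
    neg-sym : ∀ u v → neg u v ≡ neg v u
    neg⊆adj : ∀ u v → T (neg u v) → T (adj u v)

record SignifiedHom {V W : Set} (G : SignifiedGraph V) (H : SignifiedGraph W) : Set where
  private
    module G = SignifiedGraph G
    module H = SignifiedGraph H
  field
    map           : V → W
    preserve-adj  : ∀ u v → T (G.adj u v) → T (H.adj (map u) (map v))
    preserve-sign : ∀ u v → T (G.adj u v) → G.neg u v ≡ H.neg (map u) (map v)

-- The vertex u₀ is (u , false) and u₁ is (u , true).
AT : {V : Set} → SignifiedGraph V → SignifiedGraph (V × Bool)
AT H = record
  { graph   = record
    { adj        = λ (u , _) (v , _) → adj u v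
    ; adj-sym    = λ (u , _) (v , _) → adj-sym u v
    ; adj-irrefl = λ (v , _) → adj-irrefl v
    }
  ; neg     = λ (u , i) (v , j) → adj u v ∧ (neg u v xor (i xor j))
  ; neg-sym = λ (u , i) (v , j) →
      cong₂ _∧_ (adj-sym u v) (cong₂ _xor_ (neg-sym u v) (xor-comm i j))
  ; neg⊆adj = λ _ _ p → proj₁ (Equivalence.to T-∧ p)
  }
  where open SignifiedGraph H

K₄* : SignifiedGraph (Fin 4)
K₄* = record
  { graph   = record
    { adj        = λ u v → not ⌊ u ≟ v ⌋
    ; adj-sym    = distinct-sym
    ; adj-irrefl = distinct-irrefl
    }
  ; neg     = neg₀₁
  ; neg-sym = neg₀₁-sym
  ; neg⊆adj = neg₀₁⊆adj
  }
  where
  distinct-sym : ∀ (u v : Fin 4) → not ⌊ u ≟ v ⌋ ≡ not ⌊ v ≟ u ⌋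
  distinct-sym u v with u ≟ v | v ≟ u
  ... | yes _ | yes _ = refl
  ... | no  _ | no  _ = refl
  ... | yes p | no  q = contradiction (sym p) q
  ... | no  p | yes q = contradiction (sym q) p

  distinct-irrefl : ∀ (v : Fin 4) → not ⌊ v ≟ v ⌋ ≡ false
  distinct-irrefl v with v ≟ v
  ... | yes _ = refl
  ... | no  p = contradiction refl p

  neg₀₁ : Fin 4 → Fin 4 → Bool
  neg₀₁ zero       (suc zero) = true
  neg₀₁ (suc zero) zero       = true
  neg₀₁ _          _          = false

  neg₀₁-sym : ∀ u v → neg₀₁ u v ≡ neg₀₁ v u
  neg₀₁-sym zero          zero          = refl
  neg₀₁-sym zero          (suc zero)    = refl
  neg₀₁-sym zero          (suc (suc _)) = refl
  neg₀₁-sym (suc zero)    zero          = refl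
  neg₀₁-sym (suc zero)    (suc zero)    = refl
  neg₀₁-sym (suc zero)    (suc (suc _)) = refl
  neg₀₁-sym (suc (suc _)) zero          = refl
  neg₀₁-sym (suc (suc _)) (suc zero)    = refl
  neg₀₁-sym (suc (suc _)) (suc (suc _)) = refl

  neg₀₁⊆adj : ∀ u v → T (neg₀₁ u v) → T (not ⌊ u ≟ v ⌋)
  neg₀₁⊆adj zero       (suc zero) _ = _
  neg₀₁⊆adj (suc zero) zero       _ = _

-- The cycle c 0, c 1, …, c m, c 0, of length suc m.
record IsCycle {V : Set} (G : Graph V) (m : ℕ) (c : Fin (suc m) → V) : Set where
  open Graph G
  field
    length≥3 : 3 ≤ suc m
    distinct : Injective _≡_ _≡_ c
    step     : ∀ (i : Fin m) → T (adj (c (inject₁ i)) (c (suc i)))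
    close    : T (adj (c (fromℕ m)) (c zero))

-- Forests satisfy this for every g, their girth being infinite.
GirthAtLeast : {V : Set} → ℕ → Graph V → Set
GirthAtLeast {V} g G = ∀ m (c : Fin (suc m) → V) → IsCycle G m c → g ≤ suc m

-- A drawing of a finite graph in the plane is represented, as usual, by its
-- combinatorial map: the cyclic order of the edges around each vertex.

-- For an equivalence relation _~_, `NumClasses _~_ k` says that it has exactly
-- k classes.
record NumClasses {A : Set} (_~_ : A → A → Set) (k : ℕ) : Set where
  field
    class    : A → Fin k
    onto     : StrictlySurjective _≡_ class
    classify : ∀ x y → class x ≡ class y ⇔ x ~ y

module _ {V : Set} (G : Graph V) where
  open Graph G

  -- A dart is an edge with a direction; each edge carries two of them.
  record Dart : Set where
    constructor dart
    field
      tail head : V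
      edge      : T (adj tail head)

  open Dart public

  reverse : Dart → Dart
  reverse (dart u v e) = dart v u (subst T (adj-sym u v) e)

  Connected : V → V → Set
  Connected = Star (λ u v → T (adj u v))

  -- `next` sends a dart to the one following it in the rotation around its
  -- tail.  On finite graphs the field `cyclic` makes `next` a permutation
  -- whose cycles are the sets of darts with a common tail.
  record RotationSystem : Set where
    field
      next      : Dart → Dart
      next-tail : ∀ d → tail (next d) ≡ tail d
      cyclic    : ∀ d d′ → tail d ≡ tail d′ → ∃ λ k → iterate next d k ≡ d′

    -- Follows the boundary of the face on a fixed side of the dart.
    faceStep : Dart → Dart
    faceStep d = next (reverse d)

    SameFace : Dart → Dart → Set
    SameFace d d′ = ∃ λ k → iterate faceStep d k ≡ d′

  -- Euler's formula v − e + f = 2c, summed over the connected components: it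
  -- says that every component is drawn on the sphere.  Vertices, edges and
  -- components are counted through the darts they contain, so that isolated
  -- vertices, which impose no condition, are left out of both v and c, and
  -- f counts the boundary of the outer face once for each component.
  record Planar (R : RotationSystem) : Set where
    open RotationSystem R
    field
      v e f c    : ℕ
      vertices   : NumClasses {Dart} (λ d d′ → tail d ≡ tail d′) v
      edges      : NumClasses {Dart} (λ d d′ → d ≡ d′ ⊎ reverse d ≡ d′) e
      faces      : NumClasses SameFace f
      components : NumClasses {Dart} (λ d d′ → Connected (tail d) (tail d′)) c
      euler      : v + f ≡ e + 2 * c

  -- Each component has a face (the one through the dart o) incident with all
  -- its vertices.  Taking that face as the outer one in every component and
  -- drawing the components side by side puts all vertices on the outer face.
  AllVerticesOnOuterFace : RotationSystem → Set
  AllVerticesOnOuterFace R =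
    ∀ d → ∃ λ o → ∀ d′ → Connected (tail d) (tail d′) →
      ∃ λ x → SameFace o x × tail x ≡ tail d′
    where open RotationSystem R

  record Outerplanar : Set where
    field
      rotation : RotationSystem
      planar   : Planar rotation
      outer    : AllVerticesOnOuterFace rotation

{-# OPTIONS --safe #-}

-- Order the vertices of each component by their first visit on the outer face.
-- Add a vertex in the outer face, join it to all of them, and contract its star:
-- the number of faces becomes f + v - c, where c is the number of components,
-- and by Euler's formula this is e + c.  Identifying the two faces along an edge
-- loses at most one class, and doing so for all edges leaves one class per
-- component, so every single identification must lose a class.  But if the edges
-- s and t cross in the order, then the two faces along s are already identified
-- by the other edges.  So no two edges cross in the order.
--
-- Now suppose that all degrees are at least two, and take a shortest edge with a
-- vertex strictly between its ends.  The vertices between the ends form a path,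
-- with at least two vertices since there are no triangles.  So a colouring can be
-- built by removing vertices of degree at most one and pairs of adjacent vertices
-- of degree two; such a pair can be coloured again since any two vertices of
-- AT K₄* are joined by walks of length three with all prescribed signs.

module Submission where

open import Defs
open import Data.Bool as Bool using (Bool; true; false; T; _xor_)
open import Data.Bool.Properties using (T-irrelevant; T?)
open import Data.Empty using (⊥; ⊥-elim)
open import Data.Fin using (Fin; zero; suc; toℕ; join; splitAt; punchIn; punchOut)
open import Data.Fin.Properties using (_≟_; any?; all?; injective⇒≤; toℕ-injective)
open import Data.Fin.Properties using (join-splitAt; splitAt-join)
open import Data.Fin.Properties using (punchInᵢ≢i; punchIn-punchOut; punchOut-cong; punchOut-punchIn)
open import Data.Fin.Subset using (Subset; _∈_; _∉_; ⊤; ⁅_⁆; ∣_∣; _-_)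
open import Data.Fin.Subset.Properties using (_∈?_; ∈⊤; nonempty?)
open import Data.Fin.Subset.Properties using (x∈p∧x≢y⇒x∈p-y; x∈p⇒∣p-x∣<∣p∣; p─q⊆p; p─q─q≡p─q)
open import Data.Nat using (ℕ; zero; suc; _+_; _*_; _∸_; _≤_; _<_; z≤n; s≤s)
open import Data.Nat.GeneralisedArithmetic using (iterate)
open import Data.Nat.Induction using (<-wellFounded)
import Data.Nat.Properties as ℕ
open import Data.Nat.Solver using (module +-*-Solver)
open import Data.Product using (∃; ∃₂; _×_; _,_; proj₁; proj₂)
open import Data.Sum using (_⊎_; inj₁; inj₂; swap)
open import Data.Vec.Functional using (updateAt)
open import Data.Vec.Functional.Properties using (updateAt-updates; updateAt-minimal)
open import Function using (id; const; _∘_)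
open import Function.Bundles using (Equivalence)
open import Function.Definitions using (StrictlySurjective)
open import Induction.WellFounded using (Acc; acc)
open import Relation.Binary.Construct.Closure.ReflexiveTransitive using (ε; _◅_)
open import Relation.Binary.Definitions using (DecidableEquality; Tri; tri<; tri≈; tri>)
open import Relation.Binary.PropositionalEquality
open import Relation.Nullary using (Dec; yes; no; contradiction; ¬?; _×-dec_; _→-dec_)
open import Relation.Nullary.Decidable using (map′; from-yes; decidable-stable)
open import Relation.Unary using (Decidable)

-- Minima, bounds and iteration

least : {P : ℕ → Set} → Decidable P → ∀ m → P m → ∃ λ k → P k × (∀ j → P j → k ≤ j)
least P? m Pm with P? 0
... | yes P0 = 0 , P0 , λ _ _ → z≤n
least P? zero    P0 | no ¬P0 = contradiction P0 ¬P0
least P? (suc m) Pm | no ¬P0 =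
  let k , Pk , minimal = least (P? ∘ suc) m Pm
  in suc k , Pk , λ { zero P0 → contradiction P0 ¬P0 ; (suc j) Pj → s≤s (minimal j Pj) }

strictUpperBound : ∀ {n} (h : Fin n → ℕ) → ∃ λ L → ∀ u → h u < L
strictUpperBound {zero}  h = 0 , λ ()
strictUpperBound {suc n} h =
  let L , h<L = strictUpperBound (h ∘ suc)
  in suc (h zero) + L , λ
    { zero    → ℕ.m≤m+n (suc (h zero)) L
    ; (suc u) → ℕ.≤-trans (h<L u) (ℕ.m≤n+m L (suc (h zero))) }

-- If `j < i`, then `i * L` is at least `j * L + L`, beyond `j * L + y`. This reads the leading part
-- off a lexicographic key.
lex-≤ : ∀ {L} i j {x y} → y < L → i * L + x ≤ j * L + y → i ≤ j
lex-≤ {L} i j {x} {y} y<L le = ℕ.≮⇒≥ λ j<i → ℕ.<-irrefl refl (begin-strict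
  j * L + y  <⟨ ℕ.+-monoʳ-< (j * L) y<L ⟩
  j * L + L  ≡⟨ ℕ.+-comm (j * L) L ⟩
  suc j * L  ≤⟨ ℕ.*-monoˡ-≤ L j<i ⟩
  i * L      ≤⟨ ℕ.m≤m+n (i * L) x ⟩
  i * L + x  ≤⟨ le ⟩
  j * L + y  ∎)
  where open ℕ.≤-Reasoning

module _ {A : Set} (f : A → A) where

  iterate-shift : ∀ x k → iterate f (f x) k ≡ f (iterate f x k)
  iterate-shift x zero    = refl
  iterate-shift x (suc k) = iterate-shift (f x) k

  iterate-+ : ∀ x j k → iterate f x (j + k) ≡ iterate f (iterate f x j) k
  iterate-+ x zero    k = refl
  iterate-+ x (suc j) k = iterate-+ (f x) j k

  iterate-period : ∀ {x} j m → iterate f x j ≡ x → iterate f x (m * j) ≡ x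
  iterate-period         j zero    per = refl
  iterate-period {x = x} j (suc m) per = trans (iterate-+ x j (m * j))
    (trans (cong (λ y → iterate f y (m * j)) per) (iterate-period j m per))

  -- If k + 1 and l + 1 are periods of f a = f b leading back to a and b, then
  -- both a and b are reached from there after (k + 1)(l + 1) - 1 steps.
  recurrent⇒injective : (∀ x → ∃ λ k → iterate f (f x) k ≡ x) → ∀ {a b} → f a ≡ f b → a ≡ b
  recurrent⇒injective back {a} {b} fa≡fb =
    trans (sym (around (f a) (proj₁ (back a)) (proj₁ (back b)) refl (proj₂ (back a))))
      (trans (cong (iterate f (f a)) (symmetric (proj₁ (back a)) (proj₁ (back b))))
        (around (f a) (proj₁ (back b)) (proj₁ (back a)) (sym fa≡fb)
          (trans (cong (λ y → iterate f y (proj₁ (back b))) fa≡fb) (proj₂ (back b)))))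
    where
    around : ∀ y k l {x} → f x ≡ y → iterate f y k ≡ x → iterate f y (l * suc k + k) ≡ x
    around y k l fx≡y reach = trans (iterate-+ y (l * suc k) k)
      (trans (cong (λ z → iterate f z k)
        (iterate-period (suc k) l (trans (iterate-shift y k) (trans (cong f reach) fx≡y)))) reach)
    symmetric : ∀ k l → l * suc k + k ≡ k * suc l + l
    symmetric = solve 2 (λ k l → l :* (con 1 :+ k) :+ k := k :* (con 1 :+ l) :+ l) refl
      where open +-*-Solver

-- Quotients of finite sets

surjective⇒≤ : ∀ {m k} {f : Fin m → Fin k} → StrictlySurjective _≡_ f → k ≤ m
surjective⇒≤ {f = f} sur = injective⇒≤ {f = proj₁ ∘ sur} λ {x} {y} eq →
  trans (sym (proj₂ (sur x))) (trans (cong f eq) (proj₂ (sur y)))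

identify : ∀ {k} (a b : Fin k) → ∃ λ k′ → ∃ λ (q : Fin k → Fin k′) →
           StrictlySurjective _≡_ q × q a ≡ q b × k ≤ suc k′
identify {k} a b with b ≟ a
... | yes b≡a = k , id , (λ y → y , refl) , sym b≡a , ℕ.n≤1+n k
identify {suc k} a b | no b≢a = k , q , q-onto , q-glues , ℕ.≤-refl
  where
  q : Fin (suc k) → Fin k
  -- The index `b` is closed up, and `b` itself goes where `a` goes.
  q x with b ≟ x
  ... | yes _  = punchOut b≢a
  ... | no b≢x = punchOut b≢x
  q-onto : StrictlySurjective _≡_ q
  q-onto y = punchIn b y , eq
    where
    eq : q (punchIn b y) ≡ y
    eq with b ≟ punchIn b y
    ... | yes b≡ = contradiction (sym b≡) (punchInᵢ≢i b y)
    ... | no  b≢ = trans (punchOut-cong b refl) (punchOut-punchIn b)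
  q-glues : q a ≡ q b
  q-glues with b ≟ a | b ≟ b
  ... | yes b≡a | _       = contradiction b≡a b≢a
  ... | no _    | yes _   = punchOut-cong b refl
  ... | no _    | no b≢b  = contradiction refl b≢b

identifyPairs : ∀ {k} m (a b : Fin m → Fin k) → ∃ λ k′ → ∃ λ (q : Fin k → Fin k′) →
                StrictlySurjective _≡_ q × (∀ j → q (a j) ≡ q (b j)) × k ≤ k′ + m
identifyPairs {k} zero    a b = k , id , (λ y → y , refl) , (λ ()) , ℕ.m≤m+n k 0
identifyPairs {k} (suc m) a b
  with k₁ , q , q-onto , q-glues , k≤ ← identifyPairs m (a ∘ suc) (b ∘ suc)
  with k₂ , r , r-onto , r-glues , k₁≤ ← identify (q (a zero)) (q (b zero))
  = k₂ , r ∘ q , onto , glues , bound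
  where
  onto : StrictlySurjective _≡_ (r ∘ q)
  onto y with z , rz≡y ← r-onto y with x , qx≡z ← q-onto z = x , trans (cong r qx≡z) rz≡y
  glues : ∀ j → r (q (a j)) ≡ r (q (b j))
  glues zero    = r-glues
  glues (suc j) = cong r (q-glues j)
  bound : k ≤ k₂ + suc m
  bound = ℕ.≤-trans k≤ (ℕ.≤-trans (ℕ.+-monoˡ-≤ m k₁≤) (ℕ.≤-reflexive (sym (ℕ.+-suc k₂ m))))

-- Each of the remaining `m - 1` identifications loses at most one class, which makes the bound
-- strict.
identifyPairsExcept : ∀ {k m} (a b : Fin m → Fin k) (i : Fin m) → ∃ λ k′ → ∃ λ (q : Fin k → Fin k′) →
  StrictlySurjective _≡_ q × (∀ j → i ≢ j → q (a j) ≡ q (b j)) × k < k′ + m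
identifyPairsExcept {k} {suc m} a b i
  with k′ , q , q-onto , q-glues , k≤ ← identifyPairs m (a ∘ punchIn i) (b ∘ punchIn i)
  = k′ , q , q-onto , glues , ℕ.≤-trans (s≤s k≤) (ℕ.≤-reflexive (sym (ℕ.+-suc k′ m)))
  where
  glues : ∀ j → i ≢ j → q (a j) ≡ q (b j)
  glues j i≢j = subst (λ l → q (a l) ≡ q (b l)) (punchIn-punchOut i≢j) (q-glues (punchOut i≢j))

-- The order of first visits on the outer face

-- Injectivity is stated for ends of edges, because isolated vertices carry no dart and are never
-- met by a face walk.
record NonCrossingOrder {n} (G : Graph (Fin n)) : Set where
  open Graph G
  field
    key         : Fin n → ℕ
    injective   : ∀ {u u′ v v′} → T (adj u u′) → T (adj v v′) → key u ≡ key v → u ≡ v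
    nonCrossing : ∀ {a b c d} → T (adj a c) → T (adj b d) →
                  key a < key b → key b < key c → key c < key d → ⊥

module OuterWalk {n : ℕ} (G : Graph (Fin n)) (H : Outerplanar G) where
  open Graph G
  open Outerplanar H
  open RotationSystem rotation using (next; next-tail; cyclic)
  open Planar planar using (v; e; f; c; vertices; edges; faces; components; euler)
  open NumClasses

  D : Set
  D = Dart G

  φ : D → D
  φ = RotationSystem.faceStep rotation

  rev : D → D
  rev = reverse G

  dart-≡ : {d d′ : D} → tail d ≡ tail d′ → head d ≡ head d′ → d ≡ d′
  dart-≡ {dart u w x} {dart .u .w y} refl refl = cong (dart u w) (T-irrelevant x y)

  _≟ᴰ_ : DecidableEquality D
  d ≟ᴰ d′ with tail d ≟ tail d′ | head d ≟ head d′
  ... | yes p | yes q = yes (dart-≡ p q)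
  ... | no ¬p | _     = no (¬p ∘ cong tail)
  ... | yes _ | no ¬q = no (¬q ∘ cong head)

  rev-rev : ∀ d → rev (rev d) ≡ d
  rev-rev d = dart-≡ refl refl

  rev-injective : ∀ {d d′} → rev d ≡ rev d′ → d ≡ d′
  rev-injective eq = trans (sym (rev-rev _)) (trans (cong rev eq) (rev-rev _))

  φ-rev : ∀ d → φ (rev d) ≡ next d
  φ-rev d = cong next (rev-rev d)

  next-back : ∀ d → ∃ λ k → iterate next (next d) k ≡ d
  next-back d = cyclic (next d) d (next-tail d)

  -- Rotating leads from `next d` back to `d`, so `next` is injective, and `φ` is `next` after an
  -- involution.
  φ-injective : ∀ {d d′} → φ d ≡ φ d′ → d ≡ d′
  φ-injective = rev-injective ∘ recurrent⇒injective next next-back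

  comp : D → Fin c
  comp = class components

  comp-connected : ∀ {d d′} → Connected G (tail d) (tail d′) → comp d ≡ comp d′
  comp-connected = Equivalence.from (classify components _ _)

  comp-cong : ∀ {d d′} → tail d ≡ tail d′ → comp d ≡ comp d′
  comp-cong eq = comp-connected (subst (Connected G _) eq ε)

  comp-rev : ∀ d → comp (rev d) ≡ comp d
  comp-rev d = sym (comp-connected (edge d ◅ ε))

  comp-φ : ∀ d → comp (φ d) ≡ comp d
  comp-φ d = trans (comp-cong (next-tail (rev d))) (comp-rev d)

  root : Fin c → D
  root i = proj₁ (outer (proj₁ (onto components i)))

  -- Here `φ` is applied last, whereas `iterate` applies it first; so positions `k` and `suc k` are
  -- related by definition.
  walk : Fin c → ℕ → D
  walk i zero    = root i
  walk i (suc k) = φ (walk i k)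

  iterate≡walk : ∀ i k → iterate φ (root i) k ≡ walk i k
  iterate≡walk i zero    = refl
  iterate≡walk i (suc k) = trans (iterate-shift φ (root i) k) (cong φ (iterate≡walk i k))

  visit : ∀ i d → comp d ≡ i → ∃ λ k → tail (walk i k) ≡ tail d
  visit i d comp≡i =
    let base , base∈i            = onto components i
        x , (k , reach) , tail≡ = proj₂ (outer base) d
          (Equivalence.to (classify components _ _) (trans base∈i (sym comp≡i)))
    in k , trans (cong tail (trans (sym (iterate≡walk i k)) reach)) tail≡

  comp-walk-root : ∀ i k → comp (walk i k) ≡ comp (root i)
  comp-walk-root i zero    = refl
  comp-walk-root i (suc k) = trans (comp-φ (walk i k)) (comp-walk-root i k)

  -- The walk from the root reaches a representative of component `i`, and `φ` preserves components.
  comp-root : ∀ i → comp (root i) ≡ i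
  comp-root i =
    let base , base∈i = onto components i
        k , tail≡     = visit i base base∈i
    in trans (sym (comp-walk-root i k)) (trans (comp-cong tail≡) base∈i)

  comp-walk : ∀ i k → comp (walk i k) ≡ i
  comp-walk i k = trans (comp-walk-root i k) (comp-root i)

  abstract
    firstVisit : ∀ d → ∃ λ k → tail (walk (comp d) k) ≡ tail d ×
                 (∀ j → tail (walk (comp d) j) ≡ tail d → k ≤ j)
    firstVisit d =
      let k , tail≡ = visit (comp d) d refl
      in least (λ k → tail (walk (comp d) k) ≟ tail d) k tail≡

  time : D → ℕ
  time d = proj₁ (firstVisit d)

  time-hit : ∀ {i} d → comp d ≡ i → tail (walk i (time d)) ≡ tail d
  time-hit d refl = proj₁ (proj₂ (firstVisit d))

  time-min : ∀ {i} d {k} → comp d ≡ i → tail (walk i k) ≡ tail d → time d ≤ k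
  time-min d {k} refl = proj₂ (proj₂ (firstVisit d)) k

  time-cong : ∀ {d d′} → tail d ≡ tail d′ → time d ≡ time d′
  time-cong {d} {d′} eq = ℕ.≤-antisym
    (time-min d refl (trans (time-hit d′ (sym (comp-cong eq))) (sym eq)))
    (time-min d′ refl (trans (time-hit d (comp-cong eq)) eq))

  time-injective : ∀ {d d′} → comp d ≡ comp d′ → time d ≡ time d′ → tail d ≡ tail d′
  time-injective {d} {d′} ceq teq = trans (sym (time-hit d ceq))
    (trans (cong (tail ∘ walk (comp d′)) teq) (time-hit d′ refl))

  -- The corner of the outer face where the extra vertex is joined to the tail of `d`.
  first : D → D
  first d = walk (comp d) (time d)

  tail-first : ∀ d → tail (first d) ≡ tail d
  tail-first d = time-hit d refl

  first-cong : ∀ {d d′} → tail d ≡ tail d′ → first d ≡ first d′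
  first-cong eq = cong₂ walk (comp-cong eq) (time-cong eq)

  first-root : ∀ d → time d ≡ 0 → first d ≡ root (comp d)
  first-root d eq = cong (walk (comp d)) eq

  -- A dart at the vertex discovered most recently within k steps.
  latest : Fin c → ℕ → D
  latest i zero    = root i
  latest i (suc k) with time (walk i (suc k)) ℕ.≟ suc k
  ... | yes _ = walk i (suc k)
  ... | no  _ = latest i k

  latest-old : ∀ i k → time (walk i (suc k)) ≢ suc k → latest i (suc k) ≡ latest i k
  latest-old i k old with time (walk i (suc k)) ℕ.≟ suc k
  ... | yes new = contradiction new old
  ... | no  _   = refl

  comp-latest : ∀ i k → comp (latest i k) ≡ i
  comp-latest i zero    = comp-root i
  comp-latest i (suc k) with time (walk i (suc k)) ℕ.≟ suc k
  ... | yes _ = comp-walk i (suc k)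
  ... | no  _ = comp-latest i k

  latest-time : ∀ d {k} → time d ≡ k → tail (latest (comp d) k) ≡ tail d
  latest-time d {zero}  eq = trans (cong (tail ∘ walk (comp d)) (sym eq)) (tail-first d)
  latest-time d {suc k} eq with time (walk (comp d) (suc k)) ℕ.≟ suc k
  ... | yes _  = trans (cong (tail ∘ walk (comp d)) (sym eq)) (tail-first d)
  ... | no old = contradiction (trans (time-cong hit) eq) old
    where
    hit : tail (walk (comp d) (suc k)) ≡ tail d
    hit = trans (cong (tail ∘ walk (comp d)) (sym eq)) (tail-first d)

  latest-≤ : ∀ i k → time (latest i k) ≤ k
  latest-≤ i zero = time-min (root i) (comp-root i) refl
  latest-≤ i (suc k) with time (walk i (suc k)) ℕ.≟ suc k
  ... | yes new = ℕ.≤-reflexive new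
  ... | no  _   = ℕ.m≤n⇒m≤1+n (latest-≤ i k)

  latest-max : ∀ {i} k w → comp w ≡ i → time w ≤ k → time w ≤ time (latest i k)
  latest-max zero w w∈i le = ℕ.≤-trans le z≤n
  latest-max {i} (suc k) w w∈i le with time (walk i (suc k)) ℕ.≟ suc k
  ... | yes new = ℕ.≤-trans le (ℕ.≤-reflexive (sym new))
  ... | no  old = latest-max k w w∈i (ℕ.≤-pred (ℕ.≤∧≢⇒< le λ eq →
    old (trans (time-cong (trans (cong (tail ∘ walk i) (sym eq)) (time-hit w w∈i))) eq)))

  -- The walk goes round the outer face again and again; fixing the first passage through `d` puts
  -- `d` into a definite piece of that face.
  arrival : ∀ d → class faces (root (comp d)) ≡ class faces d →
            ∃ λ k → walk (comp d) k ≡ d × (∀ j → walk (comp d) j ≡ d → k ≤ j)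
  arrival d outer-d =
    let k , reach = Equivalence.to (classify faces _ _) outer-d
    in least (λ k → walk (comp d) k ≟ᴰ d) k (trans (sym (iterate≡walk (comp d) k)) reach)

  -- The faces after an extra vertex, placed in each outer face, has been joined
  -- to the first visited corner of every vertex: the outer face is cut into
  -- one piece for every vertex, the others remain.
  label : D → Fin f ⊎ Fin v
  label d with class faces (root (comp d)) ≟ class faces d
  ... | no  _       = inj₁ (class faces d)
  ... | yes outer-d = inj₂ (class vertices (latest (comp d) (proj₁ (arrival d outer-d))))

  faces-φ : ∀ d → class faces (φ d) ≡ class faces d
  faces-φ d = sym (Equivalence.from (classify faces _ _) (1 , refl))

  faces-walk : ∀ i k → class faces (root i) ≡ class faces (walk i k)
  faces-walk i zero    = refl
  faces-walk i (suc k) = trans (faces-walk i k) (sym (faces-φ (walk i k)))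

  label-inner : ∀ d → class faces (root (comp d)) ≢ class faces d → label d ≡ inj₁ (class faces d)
  label-inner d inner with class faces (root (comp d)) ≟ class faces d
  ... | no  _     = refl
  ... | yes outer = contradiction outer inner

  label-outer : ∀ {i} d j → comp d ≡ i → walk i j ≡ d → (∀ k → walk i k ≡ d → j ≤ k) →
                label d ≡ inj₂ (class vertices (latest i j))
  label-outer d j refl reach minimal with class faces (root (comp d)) ≟ class faces d
  ... | no inner = contradiction (trans (faces-walk (comp d) j) (cong (class faces) reach)) inner
  ... | yes outer-d =
    let j′ , reach′ , minimal′ = arrival d outer-d
    in cong (inj₂ ∘ class vertices ∘ latest (comp d)) (ℕ.≤-antisym (minimal′ j reach) (minimal j′ reach′))

  class-vertices-cong : ∀ {d d′} → tail d ≡ tail d′ → class vertices d ≡ class vertices d′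
  class-vertices-cong = Equivalence.from (classify vertices _ _)

  -- At the step of its discovery a vertex is itself the latest one, and the walk cannot have passed
  -- this dart before.
  label-first : ∀ d → label (first d) ≡ inj₂ (class vertices d)
  label-first d = trans
    (label-outer (first d) (time d) (comp-walk (comp d) (time d)) refl
      λ k reach → time-min d refl (trans (cong tail reach) (tail-first d)))
    (cong inj₂ (class-vertices-cong (latest-time d refl)))

  -- Inner faces keep their label. On the outer walk the latest vertex changes only when a new one
  -- is discovered, that is, at a first corner.
  label-φ : ∀ d → φ d ≢ first (φ d) → label (φ d) ≡ label d
  label-φ d notFirst = byFace (class faces (root (comp d)) ≟ class faces d)
    where
    new⇒first : ∀ k → walk (comp d) k ≡ φ d → time (φ d) ≡ k → φ d ≡ first (φ d)
    new⇒first k reach eq = trans (sym reach) (sym (cong₂ walk (comp-φ d) eq))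

    onWalk : ∀ j → walk (comp d) j ≡ φ d → (∀ k → walk (comp d) k ≡ φ d → j ≤ k) → label (φ d) ≡ label d
    -- Position `0` is the root, where its vertex is discovered, so it is a first corner.
    onWalk zero reach _ = contradiction (new⇒first 0 reach
      (ℕ.n≤0⇒n≡0 (time-min (φ d) (comp-φ d) (cong tail reach)))) notFirst
    onWalk (suc j) reach minimal = begin
      label (φ d)                                        ≡⟨ label-outer (φ d) (suc j) (comp-φ d) reach minimal ⟩
      inj₂ (class vertices (latest (comp d) (suc j)))    ≡⟨ cong (inj₂ ∘ class vertices) (latest-old (comp d) j old) ⟩
      inj₂ (class vertices (latest (comp d) j))          ≡⟨ label-outer d j refl (φ-injective reach) (λ k reach′ →
                                                              ℕ.≤-pred (minimal (suc k) (cong φ reach′))) ⟨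
      label d                                            ∎
      where
      open ≡-Reasoning
      old : time (walk (comp d) (suc j)) ≢ suc j
      old eq = notFirst (new⇒first (suc j) reach (trans (cong time (sym reach)) eq))

    byFace : Dec (class faces (root (comp d)) ≡ class faces d) → label (φ d) ≡ label d
    byFace (no inner) = begin
      label (φ d)               ≡⟨ label-inner (φ d) (λ eq → inner (trans
                                     (cong (class faces ∘ root) (sym (comp-φ d))) (trans eq (faces-φ d)))) ⟩
      inj₁ (class faces (φ d))  ≡⟨ cong inj₁ (faces-φ d) ⟩
      inj₁ (class faces d)      ≡⟨ label-inner d inner ⟨
      label d                   ∎
      where open ≡-Reasoning
    byFace (yes outer-d) =
      let j , reach , minimal = arrival (φ d)
            (trans (cong (class faces ∘ root) (comp-φ d)) (trans outer-d (sym (faces-φ d))))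
      in onWalk j (subst (λ i → walk i j ≡ φ d) (comp-φ d) reach)
           (subst (λ i → ∀ k → walk i k ≡ φ d → j ≤ k) (comp-φ d) minimal)

  -- By injectivity of `φ`, the dart `y` is at position `j` of the walk; an earlier passage through
  -- it would have discovered the tail of `d` too early.
  label-before : ∀ d {j} y → time d ≡ suc j → φ y ≡ first d →
                 label y ≡ inj₂ (class vertices (latest (comp d) j))
  label-before d {j} y eq φy = label-outer y j comp-y
    (φ-injective (trans (cong (walk (comp d)) (sym eq)) (sym φy)))
    λ k reach → ℕ.≤-pred (subst (_≤ suc k) eq
      (time-min d refl (trans (cong tail (trans (cong φ reach) φy)) (tail-first d))))
    where
    comp-y : comp y ≡ comp d
    comp-y = trans (sym (comp-φ y)) (trans (cong comp φy) (comp-walk (comp d) (time d)))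

  turn : D → ℕ → D
  turn d zero    = first d
  turn d (suc m) = next (turn d m)

  tail-turn : ∀ d m → tail (turn d m) ≡ tail d
  tail-turn d zero    = tail-first d
  tail-turn d (suc m) = trans (next-tail (turn d m)) (tail-turn d m)

  iterate≡turn : ∀ d m → iterate next (first d) m ≡ turn d m
  iterate≡turn d zero    = refl
  iterate≡turn d (suc m) = trans (iterate-shift next (first d) m) (cong next (iterate≡turn d m))

  turn-reaches : ∀ d d′ → tail d ≡ tail d′ → ∃ λ m → turn d m ≡ d′
  turn-reaches d d′ eq =
    let m , reach = cyclic (first d) d′ (trans (tail-first d) eq)
    in m , trans (sym (iterate≡turn d m)) reach

  -- Identifying faces across edges

  module Quotient {K : Set} (q : Fin f ⊎ Fin v → K) where

    g : D → K
    g d = q (label d)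

    -- The labels of `d` and `rev d` are those of the faces on the two sides of their edge.
    Glued : D → Set
    Glued d = g d ≡ g (rev d)

    -- Rotate by crossing an edge to its reverse, then following the face, since `φ (rev d)` is
    -- `next d`. Only the first corner could change the label, and there the rotation is back at its
    -- start.
    turn-constant : ∀ d m → (∀ j → j < m → Glued (turn d j)) → g (turn d m) ≡ g (first d)
    turn-constant d zero    glued = refl
    turn-constant d (suc m) glued with next (turn d m) ≟ᴰ first d
    ... | yes eq = cong g eq
    ... | no neq = begin
      g (next (turn d m))  ≡⟨ cong g (φ-rev (turn d m)) ⟨
      g (φ (rev (turn d m)))  ≡⟨ cong q (label-φ (rev (turn d m)) notFirst) ⟩
      g (rev (turn d m))  ≡⟨ glued m ℕ.≤-refl ⟨
      g (turn d m)  ≡⟨ turn-constant d m (λ j j<m → glued j (ℕ.m<n⇒m<1+n j<m)) ⟩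
      g (first d)  ∎
      where
      open ≡-Reasoning
      notFirst : φ (rev (turn d m)) ≢ first (φ (rev (turn d m)))
      notFirst eq = neq (trans (sym (φ-rev (turn d m))) (trans eq
        (first-cong (trans (next-tail _) (tail-turn d m)))))

    at-glued-vertex : ∀ d → (∀ d′ → tail d′ ≡ tail d → Glued d′) →
                      ∀ d′ → tail d′ ≡ tail d → g d′ ≡ g (first d)
    at-glued-vertex d glued d′ eq with turn-reaches d d′ (sym eq)
    ... | m , refl = turn-constant d m λ j _ → glued (turn d j) (tail-turn d j)

    -- The rotation from the first corner can stop on reaching `d`, before the edge of `d` has to be
    -- crossed.
    at-exception : ∀ d → (∀ d′ → tail d′ ≡ tail d → d′ ≢ d → Glued d′) → g d ≡ g (first d)
    at-exception d glued =
      let m , reach            = turn-reaches d d refl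
          k , reach′ , minimal = least (λ m → turn d m ≟ᴰ d) m reach
      in trans (cong g (sym reach′)) (turn-constant d k λ j j<k →
           glued (turn d j) (tail-turn d j) λ eq → ℕ.<⇒≱ j<k (minimal j eq))

    -- At the first corner of a vertex, the edge from the vertex discovered just before it to the
    -- extra vertex bounds the preceding piece. Going round the vertex to the dart before its first
    -- corner and crossing that edge leads into this piece.
    link : ∀ d {j} → time d ≡ suc j → (∀ d′ → tail d′ ≡ tail d → Glued d′) →
           g (first d) ≡ g (first (latest (comp d) j))
    link d {j} eq glued = begin
      g (first d)   ≡⟨ at-glued-vertex d glued z tail-z ⟨
      g z           ≡⟨ glued z tail-z ⟩
      g (rev z)     ≡⟨ cong q (label-before d (rev z) eq (trans (φ-rev z) next-z)) ⟩
      q (inj₂ (class vertices (latest (comp d) j)))  ≡⟨ cong q (label-first (latest (comp d) j)) ⟨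
      g (first (latest (comp d) j))  ∎
      where
      open ≡-Reasoning
      period : ℕ
      period = proj₁ (next-back (first d))
      -- The predecessor of `first d` in the rotation; `rev z` is therefore its predecessor on the
      -- outer walk.
      z : D
      z = iterate next (first d) period
      next-z : next z ≡ first d
      next-z = trans (sym (iterate-shift next (first d) period)) (proj₂ (next-back (first d)))
      tail-z : tail z ≡ tail d
      tail-z = trans (cong tail (iterate≡turn d period)) (tail-turn d period)

    -- Repeat `link` from each vertex to the one discovered before it, until the vertex of `d₀` is
    -- reached.
    descend : ∀ d₀ d → Acc _<_ (time d) → comp d ≡ comp d₀ → time d₀ ≤ time d →
              (∀ d′ → comp d′ ≡ comp d₀ → time d₀ < time d′ → time d′ ≤ time d → Glued d′) →
              g (first d) ≡ g (first d₀)
    descend d₀ d (acc rs) same le glued with time d₀ ℕ.≟ time d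
    ... | yes eq = cong g (first-cong (time-injective same (sym eq)))
    ... | no neq = step (time d) refl
      where
      step : ∀ k → time d ≡ k → g (first d) ≡ g (first d₀)
      step zero    eq = contradiction (ℕ.≤-antisym le (subst (_≤ time d₀) (sym eq) z≤n)) neq
      step (suc j) eq = trans
        (link d eq λ d′ tails → glued d′ (trans (comp-cong tails) same)
          (subst (time d₀ <_) (sym (time-cong tails)) earlier) (ℕ.≤-reflexive (time-cong tails)))
        (descend d₀ prior (rs prior<) (trans (comp-latest (comp d) j) same)
          -- The previously discovered vertex is no earlier than that of `d₀`, so the descent cannot
          -- skip it.
          (latest-max j d₀ (sym same) (ℕ.≤-pred (subst (time d₀ <_) eq earlier)))
          λ d′ same′ later le′ → glued d′ same′ later (ℕ.≤-trans le′ (ℕ.<⇒≤ prior<)))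
        where
        earlier : time d₀ < time d
        earlier = ℕ.≤∧≢⇒< le neq
        prior : D
        prior = latest (comp d) j
        prior< : time prior < time d
        prior< = subst (time prior <_) (sym eq) (s≤s (latest-≤ (comp d) j))

    all-glued⇒constant : (∀ d → Glued d) → ∀ d → g d ≡ g (root (comp d))
    all-glued⇒constant glued d = begin
      g d          ≡⟨ at-glued-vertex d (λ d′ _ → glued d′) d refl ⟩
      g (first d)  ≡⟨ descend r d (<-wellFounded _) (sym (comp-root _))
                        (subst (_≤ time d) (sym time-r) z≤n) (λ d′ _ _ _ → glued d′) ⟩
      g (first r)  ≡⟨ cong g (trans (first-root r time-r) (cong root (comp-root _))) ⟩
      g r          ∎
      where
      open ≡-Reasoning
      r : D
      r = root (comp d)
      time-r : time r ≡ 0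
      time-r = ℕ.n≤0⇒n≡0 (time-min r (comp-root (comp d)) refl)

    -- The sides of `s` are linked without crossing `s`: up to the tail of `t`, across `t`, then
    -- down from the head of `t` to that of `s`. The vertices passed in between are discovered
    -- strictly between the ends of `s` or after both, so the edge of `s` is not among theirs.
    crossed⇒glued : ∀ s t → comp s ≡ comp t →
      time s < time t → time t < time (rev s) → time (rev s) < time (rev t) →
      (∀ d → d ≢ s → d ≢ rev s → Glued d) → Glued s
    crossed⇒glued s t same s<t t<s′ s′<t′ others = begin
      g s  ≡⟨ at-exception s (λ d tails d≢s → others d d≢s
                        λ { refl → ℕ.<-irrefl (sym (time-cong tails)) s<s′ }) ⟩
      g (first s)  ≡⟨ descend s t (<-wellFounded _) (sym same) (ℕ.<⇒≤ s<t) (λ d _ s<d d≤t → others d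
                        (λ { refl → ℕ.<-irrefl refl s<d })
                        (λ { refl → ℕ.<⇒≱ t<s′ d≤t })) ⟨
      g (first t)  ≡⟨ at-glued-vertex t (λ d tails → others d
                        (λ { refl → ℕ.<-irrefl (time-cong tails) s<t })
                        (λ { refl → ℕ.<-irrefl (sym (time-cong tails)) t<s′ })) t refl ⟨
      g t  ≡⟨ others t (λ { refl → ℕ.<-irrefl refl s<t }) (λ { refl → ℕ.<-irrefl refl t<s′ }) ⟩
      g (rev t)  ≡⟨ at-glued-vertex (rev t) (λ d tails → others d
                        (λ { refl → ℕ.<-irrefl (time-cong tails) (ℕ.<-trans s<s′ s′<t′) })
                        (λ { refl → ℕ.<-irrefl (time-cong tails) s′<t′ })) (rev t) refl ⟩
      g (first (rev t))  ≡⟨ descend (rev s) (rev t) (<-wellFounded _)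
                        (trans (comp-rev t) (trans (sym same) (sym (comp-rev s)))) (ℕ.<⇒≤ s′<t′) (λ d _ s′<d _ → others d
                        (λ { refl → ℕ.<-asym s<s′ s′<d })
                        (λ { refl → ℕ.<-irrefl refl s′<d })) ⟩
      g (first (rev s))  ≡⟨ at-exception (rev s) (λ d tails d≢s′ → others d
                        (λ { refl → ℕ.<-irrefl (time-cong tails) s<s′ }) d≢s′) ⟨
      g (rev s)  ∎
      where
      open ≡-Reasoning
      s<s′ : time s < time (rev s)
      s<s′ = ℕ.<-trans s<t t<s′

  -- Identify the sides of all edges but `s`. More than `f + v - e` classes remain, hence more than
  -- `2 * c` by Euler's formula. But the sides of `s` are then identified too, so the darts of each
  -- component give one class; with the labels of the outer faces this makes at most `2 * c`.
  noCrossing : ∀ s t → comp s ≡ comp t →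
    time s < time t → time t < time (rev s) → time (rev s) < time (rev t) → ⊥
  noCrossing s t same s<t t<s′ s′<t′
    with k , q , q-onto , q-glues , f+v<k+e ← identifyPairsExcept
           (λ i → join f v (label (proj₁ (onto edges i))))
           (λ i → join f v (label (rev (proj₁ (onto edges i)))))
           (class edges s)
    = ℕ.<-irrefl refl (begin-strict
        f + v      <⟨ f+v<k+e ⟩
        k + e      ≤⟨ ℕ.+-monoˡ-≤ e (surjective⇒≤ cover-onto) ⟩
        c + c + e  ≡⟨ ℕ.+-comm (c + c) e ⟩
        e + (c + c)  ≡⟨ cong (λ x → e + (c + x)) (ℕ.+-identityʳ c) ⟨
        e + 2 * c  ≡⟨ euler ⟨
        v + f      ≡⟨ ℕ.+-comm v f ⟩
        f + v      ∎)
    where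
    open ℕ.≤-Reasoning
    open Quotient (q ∘ join f v)

    others : ∀ d → d ≢ s → d ≢ rev s → Glued d
    others d d≢s d≢s′ = transfer (Equivalence.to (classify edges r d) (proj₂ (onto edges (class edges d))))
      where
      r : D
      r = proj₁ (onto edges (class edges d))
      otherEdge : class edges s ≢ class edges d
      otherEdge sameEdge with Equivalence.to (classify edges s d) sameEdge
      ... | inj₁ s≡d  = d≢s (sym s≡d)
      ... | inj₂ s′≡d = d≢s′ (sym s′≡d)
      glued-r : Glued r
      glued-r = q-glues (class edges d) otherEdge
      transfer : r ≡ d ⊎ rev r ≡ d → Glued d
      transfer (inj₁ r≡d)  = subst Glued r≡d glued-r
      transfer (inj₂ r′≡d) = subst Glued r′≡d (trans (sym glued-r) (cong g (sym (rev-rev r))))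

    glued-s : Glued s
    glued-s = crossed⇒glued s t same s<t t<s′ s′<t′ others

    allGlued : ∀ d → Glued d
    allGlued d with d ≟ᴰ s | d ≟ᴰ rev s
    ... | yes refl | _        = glued-s
    ... | no _     | yes refl = trans (sym glued-s) (cong g (sym (rev-rev s)))
    ... | no d≢s   | no d≢s′  = others d d≢s d≢s′

    cover : Fin c ⊎ Fin c → Fin k
    cover (inj₁ i) = g (root i)
    -- No dart carries the label of an outer face, which has been cut into pieces, so these labels
    -- are covered separately.
    cover (inj₂ i) = q (join f v (inj₁ (class faces (root i))))

    covered : ∀ l → ∃ λ x → cover x ≡ q (join f v l)
    covered (inj₂ u) with onto vertices u
    ... | d , refl = inj₁ (comp (first d)) ,
      trans (sym (all-glued⇒constant allGlued (first d))) (cong (q ∘ join f v) (label-first d))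
    covered (inj₁ x) with onto faces x
    ... | d , refl with class faces (root (comp d)) ≟ class faces d
    ...   | yes outer-d = inj₂ (comp d) , cong (q ∘ join f v ∘ inj₁) outer-d
    ...   | no inner    = inj₁ (comp d) ,
      trans (sym (all-glued⇒constant allGlued d)) (cong (q ∘ join f v) (label-inner d inner))

    cover-onto : StrictlySurjective _≡_ (cover ∘ splitAt c)
    cover-onto y with q-onto y
    ... | l , refl with covered (splitAt f l)
    ...   | x , eq = join c c x , trans (cong cover (splitAt-join c c x))
                       (trans eq (cong q (join-splitAt f v l)))

  -- One order for all components

  dartAt : ∀ u → Dec (∃ λ w → T (adj u w))
  dartAt u = any? λ w → T? (adj u w)

  vertexTime : Fin n → ℕ
  vertexTime u with dartAt u
  ... | yes (w , x) = time (dart u w x)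
  ... | no _        = 0

  bound : ℕ
  bound = proj₁ (strictUpperBound vertexTime)

  -- Lexicographic in component and time of discovery; any dart at `u` gives the same value.
  -- Isolated vertices, being on no edge, get the default `0`.
  order : Fin n → ℕ
  order u with dartAt u
  ... | yes (w , x) = toℕ (comp (dart u w x)) * bound + time (dart u w x)
  ... | no _        = 0

  time<bound : ∀ d → time d < bound
  time<bound d = subst (_< bound) eq (proj₂ (strictUpperBound vertexTime) (tail d))
    where
    eq : vertexTime (tail d) ≡ time d
    eq with dartAt (tail d)
    ... | yes _   = time-cong refl
    ... | no none = contradiction (head d , edge d) none

  order-dart : ∀ d → order (tail d) ≡ toℕ (comp d) * bound + time d
  order-dart d with dartAt (tail d)
  ... | yes _   = cong₂ (λ i x → toℕ i * bound + x) (comp-cong refl) (time-cong refl)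
  ... | no none = contradiction (head d , edge d) none

  order-≤⇒comp-≤ : ∀ d d′ → order (tail d) ≤ order (tail d′) → toℕ (comp d) ≤ toℕ (comp d′)
  order-≤⇒comp-≤ d d′ le = lex-≤ (toℕ (comp d)) (toℕ (comp d′)) (time<bound d′)
    (subst₂ _≤_ (order-dart d) (order-dart d′) le)

  order-<⇒time-< : ∀ {d d′} → comp d ≡ comp d′ → order (tail d) < order (tail d′) → time d < time d′
  order-<⇒time-< {d} {d′} same lt = ℕ.+-cancelˡ-< (toℕ (comp d′) * bound) _ _
    (subst₂ _<_ (trans (order-dart d) (cong (λ i → toℕ i * bound + time d) same)) (order-dart d′) lt)

  nonCrossingOrder : NonCrossingOrder G
  nonCrossingOrder = record { key = order ; injective = inj ; nonCrossing = nc }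
    where
    inj : ∀ {u u′ w w′} → T (adj u u′) → T (adj w w′) → order u ≡ order w → u ≡ w
    inj {u} {u′} {w} {w′} x y eq = time-injective {d} {d′} same
      (ℕ.+-cancelˡ-≡ (toℕ (comp d′) * bound) _ _
        (trans (cong (λ i → toℕ i * bound + time d) (sym same))
          (trans (sym (order-dart d)) (trans eq (order-dart d′)))))
      where
      d d′ : D
      d  = dart u u′ x
      d′ = dart w w′ y
      same : comp d ≡ comp d′
      same = toℕ-injective (ℕ.≤-antisym (order-≤⇒comp-≤ d d′ (ℕ.≤-reflexive eq))
                                        (order-≤⇒comp-≤ d′ d (ℕ.≤-reflexive (sym eq))))
    nc : ∀ {a b x y} → T (adj a x) → T (adj b y) →
         order a < order b → order b < order x → order x < order y → ⊥
    nc {a} {b} {x} {y} ax by a<b b<x x<y = noCrossing s t same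
      (order-<⇒time-< same a<b)
      (order-<⇒time-< (trans (sym same) (sym (comp-rev s))) b<x)
      (order-<⇒time-< (trans (comp-rev s) (trans same (sym (comp-rev t)))) x<y)
      where
      s t : D
      s = dart a x ax
      t = dart b y by
      same : comp s ≡ comp t
      -- Both ends of `s` have the same component and `b` lies between them in the order, which
      -- squeezes the component of `t`.
      same = toℕ-injective (ℕ.≤-antisym (order-≤⇒comp-≤ s t (ℕ.<⇒≤ a<b))
        (subst (λ i → toℕ (comp t) ≤ toℕ i) (comp-rev s) (order-≤⇒comp-≤ t (rev s) (ℕ.<⇒≤ b<x))))

-- Reducible configurations

module _ {V : Set} (G : Graph V) where
  open Graph G

  adj-symmetric : ∀ {u v} → T (adj u v) → T (adj v u)
  adj-symmetric {u} {v} = subst T (adj-sym u v)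

  adj⇒≢ : ∀ {u v} → T (adj u v) → u ≢ v
  adj⇒≢ {u} uv refl = subst T (adj-irrefl u) uv

  girth≥4⇒triangle-free : GirthAtLeast 4 G → ∀ {a b c} → T (adj a b) → T (adj b c) → T (adj c a) → ⊥
  girth≥4⇒triangle-free girth {a} {b} {c} ab bc ca = ℕ.<-irrefl refl (girth 2 corner record
    { length≥3 = ℕ.≤-refl
    ; distinct = λ {i} {j} → distinct i j
    ; step     = λ { zero → ab ; (suc zero) → bc }
    ; close    = ca
    })
    where
    corner : Fin 3 → V
    corner zero             = a
    corner (suc zero)       = b
    corner (suc (suc zero)) = c
    distinct : ∀ i j → corner i ≡ corner j → i ≡ j
    distinct zero             zero             _  = refl
    distinct zero             (suc zero)       eq = contradiction eq (adj⇒≢ ab)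
    distinct zero             (suc (suc zero)) eq = contradiction (sym eq) (adj⇒≢ ca)
    distinct (suc zero)       zero             eq = contradiction (sym eq) (adj⇒≢ ab)
    distinct (suc zero)       (suc zero)       _  = refl
    distinct (suc zero)       (suc (suc zero)) eq = contradiction eq (adj⇒≢ bc)
    distinct (suc (suc zero)) zero             eq = contradiction eq (adj⇒≢ ca)
    distinct (suc (suc zero)) (suc zero)       eq = contradiction (sym eq) (adj⇒≢ bc)
    distinct (suc (suc zero)) (suc (suc zero)) _  = refl

-- Removing a member lowers the cardinality, yet removing `x` twice is the same as removing it once.
x∉p-x : ∀ {n} (p : Subset n) x → x ∉ p - x
x∉p-x p x x∈p-x = ℕ.<-irrefl (cong ∣_∣ (p─q─q≡p─q p ⁅ x ⁆)) (x∈p⇒∣p-x∣<∣p∣ x∈p-x)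

argmin : ∀ {n} {Q : Fin n → Set} (key : Fin n → ℕ) → Decidable Q → ∃ Q →
         ∃ λ x → Q x × (∀ y → Q y → key x ≤ key y)
argmin key Q? (x₀ , Qx₀) =
  let k , (x , Qx , key≡k) , minimal = least (λ k → any? λ x → Q? x ×-dec (key x ℕ.≟ k))
                                             (key x₀) (x₀ , Qx₀ , refl)
  in x , Qx , λ y Qy → subst (_≤ key y) (sym key≡k) (minimal (key y) (y , Qy , refl))

-- The vertices `a` and `b` only bound the neighbourhoods from above, so `pendant` includes degree
-- zero.
data Reduction {n} (G : Graph (Fin n)) (S : Subset n) : Set where
  empty   : (∀ {x} → x ∉ S) → Reduction G S
  pendant : ∀ {x} a → x ∈ S → (∀ {z} → z ∈ S → T (Graph.adj G x z) → z ≡ a) → Reduction G S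
  path    : ∀ {x y} a b → x ∈ S → y ∈ S → T (Graph.adj G x y) →
            (∀ {z} → z ∈ S → T (Graph.adj G x z) → z ≡ y ⊎ z ≡ a) →
            (∀ {z} → z ∈ S → T (Graph.adj G y z) → z ≡ x ⊎ z ≡ b) → Reduction G S

module Reduce {n} (G : Graph (Fin n)) (O : NonCrossingOrder G)
  (triangle-free : ∀ {a b c} → T (Graph.adj G a b) → T (Graph.adj G b c) → T (Graph.adj G c a) → ⊥)
  (S : Subset n) where
  open Graph G
  open NonCrossingOrder O

  Other : Fin n → Fin n → Fin n → Set
  Other x a y = y ∈ S × T (adj x y) × y ≢ a

  other? : ∀ x a → Decidable (Other x a)
  other? x a y = y ∈? S ×-dec T? (adj x y) ×-dec ¬? (y ≟ a)

  side : ∀ {w z} → T (adj w z) → key z < key w ⊎ key w < key z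
  side {w} {z} wz with ℕ.<-cmp (key z) (key w)
  ... | tri< z<w _ _ = inj₁ z<w
  ... | tri≈ _ eq _  = contradiction (sym (injective (adj-symmetric G wz) wz eq)) (adj⇒≢ G wz)
  ... | tri> _ _ w<z = inj₂ w<z

  Chord : Fin n → Fin n → Set
  Chord a b = a ∈ S × b ∈ S × T (adj a b) × ∃ λ z → z ∈ S × key a < key z × key z < key b

  chord? : ∀ a b → Dec (Chord a b)
  chord? a b = a ∈? S ×-dec b ∈? S ×-dec T? (adj a b) ×-dec
    any? λ z → z ∈? S ×-dec (key a ℕ.<? key z) ×-dec (key z ℕ.<? key b)

  -- Shortest chords when all degrees are at least two

  module _ (two : ∀ {x} → x ∈ S → ∀ a → ∃ (Other x a)) where

    -- The vertex with the least key has two neighbours, both above it, and the nearer one lies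
    -- under the edge to the farther one.
    chord-exists : ∃ (_∈ S) → ∃₂ Chord
    chord-exists nonempty with argmin key (_∈? S) nonempty
    -- Avoiding `m` itself yields some neighbour; avoiding that one yields a second.
    ... | m , m∈S , m-min with two m∈S m
    ...   | y , y∈S , my , _ with two m∈S y
    ...     | y′ , y′∈S , my′ , y′≢y = further (ℕ.<-cmp (key y) (key y′))
      where
      above : ∀ {z} → z ∈ S → T (adj m z) → key m < key z
      above {z} z∈S mz = ℕ.≤∧≢⇒< (m-min z z∈S) (adj⇒≢ G mz ∘ injective mz (adj-symmetric G mz))

      further : Tri (key y < key y′) (key y ≡ key y′) (key y′ < key y) → ∃₂ Chord
      further (tri< y<y′ _ _) = m , y′ , m∈S , y′∈S , my′ , y , y∈S , above y∈S my , y<y′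
      further (tri≈ _ eq _)   = contradiction (sym (injective (adj-symmetric G my) (adj-symmetric G my′) eq)) y′≢y
      further (tri> _ _ y′<y) = m , y , m∈S , y∈S , my , y′ , y′∈S , above y′∈S my′ , y′<y

    shortest-chord : ∃ (_∈ S) → ∃₂ λ a b → Chord a b × (∀ x y → Chord x y → key b ∸ key a ≤ key y ∸ key x)
    shortest-chord nonempty =
      let a₀ , b₀ , ch₀ = chord-exists nonempty
          k , (a , b , ch , span) , minimal = least
            (λ k → any? λ a → any? λ b → chord? a b ×-dec (key b ∸ key a ℕ.≟ k))
            (key b₀ ∸ key a₀) (a₀ , b₀ , ch₀ , refl)
      in a , b , ch , λ x y ch′ → subst (_≤ key y ∸ key x) (sym span) (minimal _ (x , y , ch′ , refl))

    module _ {a b} (a∈S : a ∈ S) (b∈S : b ∈ S) (ab : T (adj a b))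
      (shortest : ∀ x y → Chord x y → key b ∸ key a ≤ key y ∸ key x) where

      Inside : Fin n → Set
      Inside w = w ∈ S × key a < key w × key w < key b

      -- An edge leaving the interval would cross the edge from `a` to `b`.
      neighbour-between : ∀ {w z} → Inside w → T (adj w z) → key a ≤ key z × key z ≤ key b
      neighbour-between (_ , a<w , w<b) wz =
        ℕ.≮⇒≥ (λ z<a → nonCrossing (adj-symmetric G wz) ab z<a a<w w<b) ,
        ℕ.≮⇒≥ (λ b<z → nonCrossing ab wz a<w w<b b<z)

      -- Otherwise the edge from `y` to `w` is a chord that starts no earlier than `a` and ends
      -- before `b`, hence a shorter one.
      left-gap : ∀ {w y z} → Inside w → y ∈ S → z ∈ S → T (adj w y) → key y < key z → key z < key w → ⊥
      left-gap {w} {y} {z} w-in@(w∈S , a<w , w<b) y∈S z∈S wy y<z z<w = ℕ.<⇒≱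
        (ℕ.≤-<-trans (ℕ.∸-monoʳ-≤ (key w) (proj₁ (neighbour-between w-in wy))) (ℕ.∸-monoˡ-< w<b (ℕ.<⇒≤ a<w)))
        (shortest y w (y∈S , w∈S , adj-symmetric G wy , z , z∈S , y<z , z<w))

      right-gap : ∀ {w y z} → Inside w → y ∈ S → z ∈ S → T (adj w y) → key w < key z → key z < key y → ⊥
      right-gap {w} {y} {z} w-in@(w∈S , a<w , w<b) y∈S z∈S wy w<z z<y = ℕ.<⇒≱
        (ℕ.≤-<-trans (ℕ.∸-monoˡ-≤ (key w) (proj₂ (neighbour-between w-in wy))) (ℕ.∸-monoʳ-< a<w (ℕ.<⇒≤ w<b)))
        (shortest w y (w∈S , y∈S , wy , z , z∈S , w<z , z<y))

      left-unique : ∀ {w y y′} → Inside w → y ∈ S → y′ ∈ S → T (adj w y) → T (adj w y′) →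
                    key y < key w → key y′ < key w → y ≡ y′
      left-unique {w} {y} {y′} w-in y∈S y′∈S wy wy′ y<w y′<w with ℕ.<-cmp (key y) (key y′)
      ... | tri< y<y′ _ _ = ⊥-elim (left-gap w-in y∈S y′∈S wy y<y′ y′<w)
      ... | tri≈ _ eq _   = injective (adj-symmetric G wy) (adj-symmetric G wy′) eq
      ... | tri> _ _ y′<y = ⊥-elim (left-gap w-in y′∈S y∈S wy′ y′<y y<w)

      right-unique : ∀ {w y y′} → Inside w → y ∈ S → y′ ∈ S → T (adj w y) → T (adj w y′) →
                     key w < key y → key w < key y′ → y ≡ y′
      right-unique {w} {y} {y′} w-in y∈S y′∈S wy wy′ w<y w<y′ with ℕ.<-cmp (key y) (key y′)
      ... | tri< y<y′ _ _ = ⊥-elim (right-gap w-in y′∈S y∈S wy′ w<y y<y′)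
      ... | tri≈ _ eq _   = injective (adj-symmetric G wy) (adj-symmetric G wy′) eq
      ... | tri> _ _ y′<y = ⊥-elim (right-gap w-in y∈S y′∈S wy w<y′ y′<y)

      two-sides : ∀ {w} → Inside w →
        (∃ λ l → l ∈ S × T (adj w l) × key l < key w) × (∃ λ r → r ∈ S × T (adj w r) × key w < key r)
      two-sides {w} w-in@(w∈S , _) with two w∈S w
      ... | y , y∈S , wy , _ with two w∈S y
      ...   | y′ , y′∈S , wy′ , y′≢y with side wy | side wy′
      ...     | inj₁ y<w | inj₂ w<y′ = (y , y∈S , wy , y<w) , (y′ , y′∈S , wy′ , w<y′)
      ...     | inj₂ w<y | inj₁ y′<w = (y′ , y′∈S , wy′ , y′<w) , (y , y∈S , wy , w<y)
      ...     | inj₁ y<w | inj₁ y′<w = contradiction (left-unique w-in y′∈S y∈S wy′ wy y′<w y<w) y′≢y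
      ...     | inj₂ w<y | inj₂ w<y′ = contradiction (right-unique w-in y′∈S y∈S wy′ wy w<y′ w<y) y′≢y

      sides-exhaust : ∀ {w l r} → Inside w → l ∈ S → r ∈ S → T (adj w l) → T (adj w r) →
        key l < key w → key w < key r → ∀ {z} → z ∈ S → T (adj w z) → z ≡ l ⊎ z ≡ r
      sides-exhaust w-in l∈S r∈S wl wr l<w w<r z∈S wz with side wz
      ... | inj₁ z<w = inj₁ (left-unique w-in z∈S l∈S wz wl z<w l<w)
      ... | inj₂ w<z = inj₂ (right-unique w-in z∈S r∈S wz wr w<z w<r)

      -- By minimality the left neighbour of `x` is `a`. Its right neighbour `y` is not `b`, which
      -- would close a triangle, so `y` is inside too, and vertices inside have exactly one
      -- neighbour on each side.
      leftmost-path : ∀ {x} → Inside x → (∀ w → w ∈ S × key a < key w → key x ≤ key w) → Reduction G S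
      leftmost-path {x} x-in@(x∈S , a<x , _) x-min with two-sides x-in
      ... | (l , l∈S , xl , l<x) , (y , y∈S , xy , x<y) =
        let r , r∈S , yr , y<r = proj₂ (two-sides y-in)
        in path l r x∈S y∈S xy
             (λ z∈S xz → swap (sides-exhaust x-in l∈S y∈S xl xy l<x x<y z∈S xz))
             (sides-exhaust y-in x∈S r∈S (adj-symmetric G xy) yr x<y y<r)
        where
        l≡a : l ≡ a
        l≡a = injective (adj-symmetric G xl) ab (ℕ.≤-antisym
          (ℕ.≮⇒≥ λ a<l → ℕ.<⇒≱ l<x (x-min l (l∈S , a<l)))
          (proj₁ (neighbour-between x-in xl)))
        y≢b : y ≢ b
        y≢b refl = triangle-free ab (adj-symmetric G xy) (subst (T ∘ adj x) l≡a xl)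
        y-in : Inside y
        y-in = y∈S , ℕ.<-trans a<x x<y , ℕ.≤∧≢⇒< (proj₂ (neighbour-between x-in xy))
          (y≢b ∘ injective (adj-symmetric G xy) (adj-symmetric G ab))

    chord-reduction : ∃ (_∈ S) → Reduction G S
    chord-reduction nonempty =
      let a , b , (a∈S , b∈S , ab , z , z∈S , a<z , z<b) , shortest = shortest-chord nonempty
          x , (x∈S , a<x) , x-min = argmin key (λ x → x ∈? S ×-dec (key a ℕ.<? key x)) (z , z∈S , a<z)
      in leftmost-path a∈S b∈S ab shortest (x∈S , a<x , ℕ.≤-<-trans (x-min z (z∈S , a<z)) z<b) x-min

  reduction : Reduction G S
  reduction with nonempty? S
  ... | no none = empty λ x∈S → none (_ , x∈S)
  ... | yes nonempty with any? (λ x → any? (λ a → x ∈? S ×-dec ¬? (any? (other? x a))))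
  ...   | yes (x , a , x∈S , noOther) = pendant a x∈S λ {z} z∈S xz →
            decidable-stable (z ≟ a) λ z≢a → noOther (z , z∈S , xz , z≢a)
  ...   | no none = chord-reduction (λ {x} x∈S a →
            decidable-stable (any? (other? x a)) λ noOther → none (x , a , x∈S , noOther)) nonempty

-- Colouring by AT K₄*

Colour : Set
Colour = Fin 4 × Bool

module Base = SignifiedGraph K₄*
module Target = SignifiedGraph (AT K₄*)

Edge : Bool → Colour → Colour → Set
Edge s x y = T (Target.adj x y) × s ≡ Target.neg x y

Edge-sym : ∀ {s} x y → Edge s x y → Edge s y x
Edge-sym x y (xy , eq) = subst T (Target.adj-sym x y) xy , trans eq (Target.neg-sym x y)

allBool? : ∀ {P : Bool → Set} → Decidable P → Dec (∀ b → P b)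
allBool? P? = map′ (λ { (p , q) false → p ; (p , q) true → q }) (λ p → p false , p true) (P? false ×-dec P? true)

-- This forgets the lift: AT contains a walk with prescribed signs between given
-- lifts of i and j exactly when K₄* has one with the corresponding product.
abstract
  baseWalk₃ : ∀ i j t → ∃₂ λ p r → T (Base.adj i p) × T (Base.adj p r) × T (Base.adj r j) ×
              Base.neg i p xor (Base.neg p r xor Base.neg r j) ≡ t
  baseWalk₃ = from-yes (all? λ i → all? λ j → allBool? λ t → any? λ p → any? λ r →
    T? (Base.adj i p) ×-dec T? (Base.adj p r) ×-dec T? (Base.adj r j) ×-dec
    (Base.neg i p xor (Base.neg p r xor Base.neg r j) Bool.≟ t))

lift-edge : ∀ {s i j} a b → T (Base.adj i j) → s ≡ Base.neg i j xor (a xor b) → Edge s (i , a) (j , b)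
lift-edge {i = i} {j} a b ij eq with Base.adj i j
... | true = ij , eq

-- Choose the walk in `K₄*` by its product of signs. The lift of each inner vertex is solved from
-- the outer edge next to it, and the product then forces the middle sign.
walk₃ : ∀ x y s₁ s₂ s₃ → ∃₂ λ u w → Edge s₁ x u × Edge s₂ u w × Edge s₃ w y
walk₃ (i , a) (j , b) s₁ s₂ s₃ with baseWalk₃ i j (s₁ xor (s₂ xor (s₃ xor (a xor b))))
... | p , r , ip , pr , rj , eq =
  (p , a′) , (r , b′) ,
  lift-edge a a′ ip (first-sign s₁ n₁ a) ,
  lift-edge a′ b′ pr (middle-sign s₁ s₂ s₃ n₁ n₂ n₃ a b eq) ,
  lift-edge b′ b rj (last-sign s₃ n₃ b)
  where
  n₁ n₂ n₃ : Bool
  n₁ = Base.neg i p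
  n₂ = Base.neg p r
  n₃ = Base.neg r j
  a′ b′ : Bool
  a′ = a xor (s₁ xor n₁)
  b′ = b xor (s₃ xor n₃)
  first-sign : ∀ s n a → s ≡ n xor (a xor (a xor (s xor n)))
  first-sign = from-yes (allBool? λ s → allBool? λ n → allBool? λ a →
    s Bool.≟ n xor (a xor (a xor (s xor n))))
  middle-sign : ∀ s₁ s₂ s₃ n₁ n₂ n₃ a b → n₁ xor (n₂ xor n₃) ≡ s₁ xor (s₂ xor (s₃ xor (a xor b))) →
                s₂ ≡ n₂ xor ((a xor (s₁ xor n₁)) xor (b xor (s₃ xor n₃)))
  middle-sign = from-yes (allBool? λ s₁ → allBool? λ s₂ → allBool? λ s₃ →
    allBool? λ n₁ → allBool? λ n₂ → allBool? λ n₃ → allBool? λ a → allBool? λ b →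
    (n₁ xor (n₂ xor n₃) Bool.≟ s₁ xor (s₂ xor (s₃ xor (a xor b)))) →-dec
    (s₂ Bool.≟ n₂ xor ((a xor (s₁ xor n₁)) xor (b xor (s₃ xor n₃)))))
  last-sign : ∀ s n b → s ≡ n xor ((b xor (s xor n)) xor b)
  last-sign = from-yes (allBool? λ s → allBool? λ n → allBool? λ b →
    s Bool.≟ n xor ((b xor (s xor n)) xor b))

-- Extending colourings over reductions

module Colouring {n} (G : SignifiedGraph (Fin n)) where
  open SignifiedGraph G

  ProperOn : Subset n → (Fin n → Colour) → Set
  ProperOn S h = ∀ {u w} → u ∈ S → w ∈ S → T (adj u w) → Edge (neg u w) (h u) (h w)

  recolour : (Fin n → Colour) → Fin n → Colour → Fin n → Colour
  recolour h x k = updateAt h x (const k)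

  recolour-proper : ∀ {S h} x k → ProperOn (S - x) h →
    (∀ {z} → z ∈ S → T (adj x z) → Edge (neg x z) k (h z)) → ProperOn S (recolour h x k)
  recolour-proper {S} {h} x k proper fits {u} {w} u∈S w∈S uw with u ≟ x | w ≟ x
  ... | yes refl | yes refl = contradiction refl (adj⇒≢ graph uw)
  ... | yes refl | no w≢x   = subst₂ (Edge (neg u w))
    (sym (updateAt-updates u h)) (sym (updateAt-minimal w u h w≢x)) (fits w∈S uw)
  ... | no u≢x   | yes refl = subst₂ (Edge (neg u w))
    (sym (updateAt-minimal u w h u≢x)) (sym (updateAt-updates w h))
    (Edge-sym k (h u) (subst (λ s → Edge s k (h u)) (neg-sym w u) (fits u∈S (adj-symmetric graph uw))))
  ... | no u≢x   | no w≢x   = subst₂ (Edge (neg u w))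
    (sym (updateAt-minimal u x h u≢x)) (sym (updateAt-minimal w x h w≢x))
    (proper (x∈p∧x≢y⇒x∈p-y u∈S u≢x) (x∈p∧x≢y⇒x∈p-y w∈S w≢x) uw)

  colouring : (∀ S → Reduction graph S) → ∀ S → Acc _<_ ∣ S ∣ → ∃ (ProperOn S)
  colouring reduce S (acc rs) with reduce S
  ... | empty none = const (zero , false) , λ u∈S → contradiction u∈S none
  ... | pendant {x} a x∈S only =
    let h , proper = colouring reduce (S - x) (rs (x∈p⇒∣p-x∣<∣p∣ x∈S))
        -- Only the first step of the walk is kept, so its end and the other two signs are
        -- arbitrary.
        k , _ , ak , _ = walk₃ (h a) (h a) (neg x a) false false
    in recolour h x k , recolour-proper x k proper λ z∈S xz →
         subst (λ z → Edge (neg x z) k (h z)) (sym (only z∈S xz)) (Edge-sym (h a) k ak)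
  ... | path {x} {y} a b x∈S y∈S xy only-x only-y =
    let h , proper = colouring reduce (S - x - y)
          (rs (ℕ.<-trans (x∈p⇒∣p-x∣<∣p∣ y∈S-x) (x∈p⇒∣p-x∣<∣p∣ x∈S)))
        k , l , ak , kl , lb = walk₃ (h a) (h b) (neg x a) (neg x y) (neg y b)
    in recolour (recolour h y l) x k ,
       recolour-proper x k (recolour-proper y l proper (fit-y h l lb)) (fit-x h k l ak kl)
    where
    y∈S-x : y ∈ S - x
    y∈S-x = x∈p∧x≢y⇒x∈p-y y∈S (adj⇒≢ graph xy ∘ sym)

    fit-y : ∀ h l → Edge (neg y b) l (h b) →
            ∀ {z} → z ∈ S - x → T (adj y z) → Edge (neg y z) l (h z)
    fit-y h l lb z∈S-x yz with only-y (p─q⊆p S ⁅ x ⁆ z∈S-x) yz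
    ... | inj₁ refl = contradiction z∈S-x (x∉p-x S x)
    ... | inj₂ refl = lb

    fit-x : ∀ h k l → Edge (neg x a) (h a) k → Edge (neg x y) k l →
            ∀ {z} → z ∈ S → T (adj x z) → Edge (neg x z) k (recolour h y l z)
    -- Whether `z` is `y` is decided first, since `a` may coincide with `y`, which has been
    -- recoloured.
    fit-x h k l ak kl {z} z∈S xz with z ≟ y | only-x z∈S xz
    ... | yes refl | _         = subst (Edge (neg x z) k) (sym (updateAt-updates z h)) kl
    ... | no z≢y   | inj₁ z≡y  = contradiction z≡y z≢y
    ... | no z≢y   | inj₂ refl =
      subst (Edge (neg x z) k) (sym (updateAt-minimal z y h z≢y)) (Edge-sym (h a) k ak)

mainTheorem11 : (n : ℕ) (G : SignifiedGraph (Fin n)) →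
    Outerplanar (SignifiedGraph.graph G) →
    GirthAtLeast 4 (SignifiedGraph.graph G) →
    SignifiedHom G (AT K₄*)
mainTheorem11 n G outerplanar girth =
  let h , proper = colouring reduce ⊤ (<-wellFounded _)
  in record
    { map           = h
    ; preserve-adj  = λ u w uw → proj₁ (proper ∈⊤ ∈⊤ uw)
    ; preserve-sign = λ u w uw → proj₂ (proper ∈⊤ ∈⊤ uw)
    }
  where
  open SignifiedGraph G using (graph)
  open Colouring G
  reduce : ∀ S → Reduction graph S
  reduce = Reduce.reduction graph (OuterWalk.nonCrossingOrder graph outerplanar)
    (girth≥4⇒triangle-free graph girth)
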